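{- Let $q$ be an odd prime power, and let $S_1$ and $S_2$ be two non-equivalent special spreads in $\mathrm{PG}(3,q)$ (with respect to the same symplectic polarity). Then the graphs $\Gamma_{q,S_1}$ and $\Gamma_{q,S_2}$ are not isomorphic.
   Context: A symplectic polarity $\zeta$ of $\mathrm{PG}(3,q)$ is a polarity with $x\in x^\zeta$ for every point $x$. The graph $Sp(4,q)$ has the points of $\mathrm{PG}(3,q)$ as vertices, two distinct points $x,y$ being adjacent iff $y\in x^\zeta$ (i.e. $x$ and $y$ are orthogonal). A line $L$ is totally isotropic if $L^\zeta=L$. A spread is a set of lines of $\mathrm{PG}(3,q)$ partitioning its point set. For $q$ odd, a special spread is a spread $S$ consisting of lines that are not totally isotropic such that for every $\ell\in S$ there is a uniquely determined line $\ell'\in S$ such that any point of $\ell$ is orthogonal to any point of $\ell'$ (that is, $\ell'=\ell^\zeta$). For paired lines $\ell,\ell'\in S$, the set $\ell\cup\ell'$ induces in $Sp(4,q)$ a complete bipartite graph $K_{q+1,q+1}$ with parts $\ell$ and $\ell'$; these sets $\ell\cup\ell'$ partition the vertex set of $Sp(4,q)$. The graph $\Gamma_{q,S}$ is the complement of the graph obtained from $Sp(4,q)$ by removing all the edges of each of these $K_{q+1,q+1}$'s. Two special spreads are equivalent if there exists an automorphism of the graph $Sp(4,q)$ mapping one of them to the other. -}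

module Defs where

open import Algebra.Core using (Op₁; Op₂)
open import Algebra.Structures using (IsCommutativeRing)
open import Data.Fin.Base using (Fin)
open import Data.Nat.Base using (ℕ; suc; _^_)
open import Data.Nat.Primality using (Prime)
open import Data.Product using (∃; ∃!; ∃-syntax; _×_; _,_; proj₁; proj₂)
open import Data.Sum.Base using (_⊎_; inj₁; inj₂)
open import Data.Vec.Base using (Vec; foldr′; map; replicate; zipWith)
open import Data.Vec.Relation.Unary.All using (All)
open import Function.Base using (_∘_)
open import Function.Bundles using (_⇔_; _↔_; Inverse)
open import Level using (Level; 0ℓ; _⊔_) renaming (suc to lsuc)
open import Relation.Binary.Bundles using (Setoid)
open import Relation.Binary.Core using (Rel)
open import Relation.Binary.Definitions
  using (Irreflexive; Symmetric; _Respects_; _Respectsʳ_)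
import Relation.Binary.Construct.On as On
open import Relation.Binary.PropositionalEquality.Core using (_≡_; _≢_)
open import Relation.Nullary.Negation.Core using (¬_)
open import Relation.Unary using (Pred; Decidable; _∈_; _⊆_; _≐_)
open import Relation.Unary.Relation.Binary.Equality using (≐-isEquivalence)

private variable
  c ℓ e c′ ℓ′ e′ r : Level

OddPrimePower : ℕ → Set
OddPrimePower q = ∃[ p ] ∃[ k ] (Prime p × p ≢ 2 × q ≡ p ^ suc k)

record FiniteField (q : ℕ) : Set₁ where
  infix  8 -_
  infixl 7 _*_
  infixl 6 _+_
  field
    Carrier           : Set
    _+_ _*_           : Op₂ Carrier
    -_                : Op₁ Carrier
    0# 1#             : Carrier
    isCommutativeRing : IsCommutativeRing _≡_ _+_ _*_ -_ 0# 1#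
    0≢1               : 0# ≢ 1#
    inverse           : ∀ x → x ≢ 0# → ∃[ y ] x * y ≡ 1#
    enumeration       : Carrier ↔ Fin q

record Graph (V : Setoid c ℓ) e : Set (c ⊔ ℓ ⊔ lsuc e) where
  open Setoid V
  field
    Adj       : Rel Carrier e
    adj-sym   : Symmetric Adj
    adj-irr   : Irreflexive _≈_ Adj
    adj-respʳ : Adj Respectsʳ _≈_

record _≅_ {V : Setoid c ℓ} {W : Setoid c′ ℓ′} (G : Graph V e) (H : Graph W e′)
       : Set (c ⊔ ℓ ⊔ e ⊔ c′ ⊔ ℓ′ ⊔ e′) where
  field
    bijection : Inverse V W
  open Inverse bijection public using (to; from)
  field
    adjacency : ∀ x y → Graph.Adj G x y ⇔ Graph.Adj H (to x) (to y)

module _ {V : Setoid c ℓ} where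
  open Setoid V

  complement : Graph V e → Graph V (ℓ ⊔ e)
  complement G = record
    { Adj       = λ x y → ¬ (x ≈ y) × ¬ Adj x y
    ; adj-sym   = λ (x≉y , x≁y) → x≉y ∘ sym , x≁y ∘ adj-sym
    ; adj-irr   = λ x≈y (x≉y , _) → x≉y x≈y
    ; adj-respʳ = λ y≈z (x≉y , x≁y) →
        (λ x≈z → x≉y (trans x≈z (sym y≈z))) , x≁y ∘ adj-respʳ (sym y≈z)
    }
    where open Graph G

  removeEdges : Graph V e → (R : Rel Carrier r) → Symmetric R →
                R Respectsʳ _≈_ → Graph V (e ⊔ r)
  removeEdges G R R-sym R-respʳ = record
    { Adj       = λ x y → Adj x y × ¬ R x y
    ; adj-sym   = λ (x~y , ¬r) → adj-sym x~y , ¬r ∘ R-sym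
    ; adj-irr   = λ x≈y (x~y , _) → adj-irr x≈y x~y
    ; adj-respʳ = λ y≈z (x~y , ¬r) → adj-respʳ y≈z x~y , ¬r ∘ R-respʳ (sym y≈z)
    }
    where open Graph G

module PG {q : ℕ} (F : FiniteField q) where
  open FiniteField F

  F⁴ : Set
  F⁴ = Vec Carrier 4

  infixl 6 _⊕_
  infixr 7 _·_

  𝟎 : F⁴
  𝟎 = replicate 4 0#

  _⊕_ : F⁴ → F⁴ → F⁴
  _⊕_ = zipWith _+_

  _·_ : Carrier → F⁴ → F⁴
  a · v = map (a *_) v

  combination : ∀ {d} → Vec Carrier d → Vec F⁴ d → F⁴
  combination as vs = foldr′ _⊕_ 𝟎 (zipWith _·_ as vs)

  -- Decidable membership is classically no restriction; without it one could
  -- not constructively exhibit bases for arbitrary subspaces of F⁴.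
  record Subspace : Set₁ where
    field
      ⟦_⟧      : Pred F⁴ 0ℓ
      member?  : Decidable ⟦_⟧
      𝟎-closed : 𝟎 ∈ ⟦_⟧
      ⊕-closed : ∀ {u v} → u ∈ ⟦_⟧ → v ∈ ⟦_⟧ → u ⊕ v ∈ ⟦_⟧
      ·-closed : ∀ a {v} → v ∈ ⟦_⟧ → a · v ∈ ⟦_⟧
  open Subspace public using (⟦_⟧)

  infix 4 _≤_ _≈_

  _≤_ : Rel Subspace 0ℓ
  U ≤ W = ⟦ U ⟧ ⊆ ⟦ W ⟧

  _≈_ : Rel Subspace 0ℓ
  U ≈ W = ⟦ U ⟧ ≐ ⟦ W ⟧

  record HasDimension (U : Subspace) (d : ℕ) : Set where
    field
      basis       : Vec F⁴ d
      basis∈      : All (_∈ ⟦ U ⟧) basis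
      spanning    : ∀ v → v ∈ ⟦ U ⟧ → ∃[ as ] combination as basis ≡ v
      independent : ∀ as → combination as basis ≡ 𝟎 → as ≡ replicate d 0#

  -- The index is the vector space dimension, one more than the projective one.
  record Flat (d : ℕ) : Set₁ where
    field
      space     : Subspace
      dimension : HasDimension space d
  open Flat public using (space)

  Flats : ℕ → Setoid _ _
  Flats d = record
    { Carrier       = Flat d
    ; _≈_           = λ U W → space U ≈ space W
    ; isEquivalence = On.isEquivalence (⟦_⟧ ∘ space) ≐-isEquivalence
    }

  Point Line : Set₁
  Point = Flat 1
  Line  = Flat 2

  infix 4 _≈ₚ_ _≈ₗ_ _on_

  _≈ₚ_ : Rel Point 0ℓ
  _≈ₚ_ = Setoid._≈_ (Flats 1)

  _≈ₗ_ : Rel Line 0ℓ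
  _≈ₗ_ = Setoid._≈_ (Flats 2)

  _on_ : Point → Line → Set
  x on l = space x ≤ space l

  record Polarity : Set₁ where
    infix 9 _^ζ
    field
      _^ζ        : Subspace → Subspace
      reversing  : ∀ U W → U ≤ W → W ^ζ ≤ U ^ζ
      involutive : ∀ U → (U ^ζ) ^ζ ≈ U

  record SymplecticPolarity : Set₁ where
    field
      polarity : Polarity
    open Polarity polarity public
    field
      absolute : (x : Point) → space x ≤ space x ^ζ

  record IsSpread (S : Pred Line 0ℓ) : Set₁ where
    field
      respects  : S Respects _≈ₗ_
      partition : (x : Point) → ∃! _≈ₗ_ λ l → l ∈ S × x on l

module Symplectic {q : ℕ} (F : FiniteField q) (ζ : PG.SymplecticPolarity F) where
  open PG F
  open SymplecticPolarity ζ

  infix 4 _⊥_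

  _⊥_ : Rel Point 0ℓ
  x ⊥ y = space y ≤ space x ^ζ

  ⊥-sym : Symmetric _⊥_
  ⊥-sym {x} {y} x⊥y =
    reversing (space y) (space x ^ζ) x⊥y ∘ proj₂ (involutive (space x))

  Sp₄ : Graph (Flats 1) 0ℓ
  Sp₄ = record
    { Adj       = λ x y → ¬ (x ≈ₚ y) × x ⊥ y
    ; adj-sym   = λ {x} {y} (x≉y , x⊥y) →
        (λ (y⊆x , x⊆y) → x≉y (x⊆y , y⊆x)) , ⊥-sym {x} {y} x⊥y
    ; adj-irr   = λ x≈y (x≉y , _) → x≉y x≈y
    ; adj-respʳ = λ (y⊆z , z⊆y) (x≉y , x⊥y) →
        (λ (x⊆z , z⊆x) → x≉y (z⊆y ∘ x⊆z , z⊆x ∘ y⊆z)) , x⊥y ∘ z⊆y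
    }

  TotallyIsotropic : Line → Set
  TotallyIsotropic l = space l ^ζ ≈ space l

  Orthogonal : Rel Line (lsuc 0ℓ)
  Orthogonal l m = ∀ x y → x on l → y on m → x ⊥ y

  record SpecialSpread : Set₁ where
    field
      lines         : Pred Line 0ℓ
      isSpread      : IsSpread lines
      non-isotropic : ∀ l → l ∈ lines → ¬ TotallyIsotropic l
      pairing       : ∀ l → l ∈ lines → ∃! _≈ₗ_ λ m → m ∈ lines × Orthogonal l m
  open SpecialSpread public using (lines)

  -- The edges of the complete bipartite graphs with parts l and l′, for l and
  -- l′ paired lines of S.
  PairEdge : SpecialSpread → Rel Point (lsuc 0ℓ)
  PairEdge S x y = ∃[ l ] ∃[ l′ ] (l ∈ lines S × l′ ∈ lines S × Orthogonal l l′ ×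
                                   ((x on l × y on l′) ⊎ (x on l′ × y on l)))

  PairEdge-sym : ∀ S → Symmetric (PairEdge S)
  PairEdge-sym S (l , l′ , l∈S , l′∈S , l⊥l′ , inj₁ (x∈l , y∈l′)) =
    l , l′ , l∈S , l′∈S , l⊥l′ , inj₂ (y∈l′ , x∈l)
  PairEdge-sym S (l , l′ , l∈S , l′∈S , l⊥l′ , inj₂ (x∈l′ , y∈l)) =
    l , l′ , l∈S , l′∈S , l⊥l′ , inj₁ (y∈l , x∈l′)

  PairEdge-respʳ : ∀ S → PairEdge S Respectsʳ _≈ₚ_
  PairEdge-respʳ S (_ , z⊆y) (l , l′ , l∈S , l′∈S , l⊥l′ , inj₁ (x∈l , y∈l′)) =
    l , l′ , l∈S , l′∈S , l⊥l′ , inj₁ (x∈l , y∈l′ ∘ z⊆y)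
  PairEdge-respʳ S (_ , z⊆y) (l , l′ , l∈S , l′∈S , l⊥l′ , inj₂ (x∈l′ , y∈l)) =
    l , l′ , l∈S , l′∈S , l⊥l′ , inj₂ (x∈l′ , y∈l ∘ z⊆y)

  Γ : SpecialSpread → Graph (Flats 1) (lsuc 0ℓ)
  Γ S = complement (removeEdges Sp₄ (PairEdge S)
          (λ {x} {y} → PairEdge-sym S {x} {y})
          (λ {x} {y} {z} → PairEdge-respʳ S {x} {y} {z}))

  IsImage : (Point → Point) → Line → Line → Set₁
  IsImage φ l m = ∀ y → y on m ⇔ (∃[ x ] (x on l × y ≈ₚ φ x))

  Equivalent : Rel SpecialSpread (lsuc 0ℓ)
  Equivalent S₁ S₂ = ∃ λ (φ : Sp₄ ≅ Sp₄) →
    (∀ l → l ∈ lines S₁ → ∃[ m ] (m ∈ lines S₂ × IsImage (_≅_.to φ) l m)) ×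
    (∀ m → m ∈ lines S₂ → ∃[ l ] (l ∈ lines S₁ × IsImage (_≅_.to φ) l m))

{-# OPTIONS --safe #-}
-- Write x ~ y if x and y are adjacent in Sp(4,q) but not joined by an edge of one
-- of the K_{q+1,q+1}; an isomorphism of the graphs Γ preserves ~.  Distinct
-- points x ≁ y lie on a common line of the spread iff they have no common
-- ~-neighbour, and lines l ≠ m of the spread are paired iff no point of l is
-- ~-adjacent to a point of m.  So the spread, the removed edges and hence Sp(4,q)
-- are all recovered from ~, and the isomorphism itself is an equivalence.
--
-- ζ is only known to reverse inclusions.  The lattice facts needed, such as
-- l ^ζ = m for paired lines, come from dimension bounds obtained by counting:
-- there is no injection F^(n+1) → F^n.

module Submission where

open import Algebra.Bundles using (AbelianGroup; CommutativeRing)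
open import Algebra.Properties.CommutativeSemigroup using (interchange)
import Algebra.Properties.AbelianGroup as AbelianGroupProperties
open import Data.Empty using (⊥-elim)
open import Data.Fin.Base using (Fin; zero; suc)
open import Data.Fin.Properties using (any?; injective⇒≤; inj⇒≟)
open import Data.Nat.Base as ℕ using (ℕ; zero; suc; z≤n; s≤s)
open import Data.Nat.Properties using (^-monoʳ-<; ≮⇒≥; <⇒≱; n≮n)
open import Data.Product using (∃; ∃-syntax; _×_; _,_; proj₁; proj₂)
open import Data.Sum.Base using (inj₁; inj₂)
open import Data.Unit.Base using (⊤; tt)
open import Data.Vec.Base using (Vec; []; _∷_; head; map; replicate; tail; zipWith)
open import Data.Vec.Properties using
  (≡-dec; map-id; map-cong; map-∘; map-const; zipWith-assoc; zipWith-comm;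
   zipWith-identityˡ; zipWith-identityʳ; zipWith-inverseˡ; zipWith-inverseʳ)
open import Data.Vec.Recursive using (lift↔; Fin[m^n]↔Fin[m]^n)
open import Data.Vec.Recursive.Properties using (↔Vec)
open import Data.Vec.Relation.Unary.All using (All; []; _∷_)
open import Function.Base using (_∘_; id)
open import Function.Bundles using (_↔_; mk⇔; Equivalence; Injection; Inverse)
open import Function.Properties.Inverse using (↔-sym; ↔-trans; ↔⇒↣)
import Function.Construct.Symmetry as Symmetry
open import Level using (0ℓ)
open import Relation.Binary.Bundles using (Setoid)
open import Relation.Binary.Definitions using (DecidableEquality)
open import Relation.Binary.PropositionalEquality
open import Relation.Nullary.Decidable
  using (Dec; yes; no; ¬?; _×-dec_; map′; decidable-stable)
open import Relation.Nullary.Negation.Core using (¬_; contradiction)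
open import Relation.Unary using (Pred; Decidable; _∈_; _∉_)
open import Defs

Adj-resp : ∀ {c ℓ e} {V : Setoid c ℓ} (G : Graph V e) → let open Setoid V; open Graph G in
           ∀ x x′ y y′ → x ≈ x′ → y ≈ y′ → Adj x y → Adj x′ y′
Adj-resp G x x′ y y′ x≈x′ y≈y′ x~y =
  adj-sym {y′} {x′} (adj-respʳ {y′} {x} {x′} x≈x′
    (adj-sym {x} {y′} (adj-respʳ {x} {y} {y′} y≈y′ x~y)))
  where open Graph G

-- Linear algebra over a finite field.

module LinearAlgebra {q : ℕ} (F : FiniteField q) where
  open FiniteField F
  open PG F
  open Subspace using (member?; 𝟎-closed; ⊕-closed; ·-closed)

  commutativeRing : CommutativeRing 0ℓ 0ℓ
  commutativeRing = record { isCommutativeRing = isCommutativeRing }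

  open CommutativeRing commutativeRing
    using (+-assoc; +-comm; +-identityˡ; +-identityʳ; -‿inverseˡ;
           -‿inverseʳ; *-assoc; *-comm; *-identityˡ; distribˡ;
           distribʳ; zeroˡ; zeroʳ; +-abelianGroup)

  -- Decidability and counting.

  infix 4 _≟_ _≟ᵥ_

  _≟_ : DecidableEquality Carrier
  _≟_ = inj⇒≟ (↔⇒↣ enumeration)

  _≟ᵥ_ : DecidableEquality F⁴
  _≟ᵥ_ = ≡-dec _≟_

  abstract
    search : ∀ {A : Set} {n} {P : Pred A 0ℓ} → A ↔ Fin n → Decidable P → Dec (∃ P)
    search {P = P} A↔Fin P? = map′
      (λ (i , p) → from i , p)
      (λ (a , p) → to a , subst P (sym (strictlyInverseʳ a)) p)
      (any? (P? ∘ from))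
      where open Inverse A↔Fin

  enumerateVec : ∀ n → Vec Carrier n ↔ Fin (q ℕ.^ n)
  enumerateVec n = ↔-trans (↔-sym (↔Vec n))
    (↔-trans (lift↔ n enumeration) (↔-sym (Fin[m^n]↔Fin[m]^n q n)))

  1<q : 1 ℕ.< q
  1<q = injective⇒≤ {f = to ∘ pick} (pick-injective ∘ injective)
    where
    open Injection (↔⇒↣ enumeration) using (to; injective)
    pick : Fin 2 → Carrier
    pick zero    = 0#
    pick (suc _) = 1#
    pick-injective : ∀ {i j} → pick i ≡ pick j → i ≡ j
    pick-injective {zero}     {zero}     _ = refl
    pick-injective {zero}     {suc zero} e = contradiction e 0≢1
    pick-injective {suc zero} {zero}     e = contradiction (sym e) 0≢1
    pick-injective {suc zero} {suc zero} _ = refl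

  abstract
    -- The two sides have q^m and q^n elements, and since 1 < q the powers increase strictly, so n <
    -- m would leave no room for an injection.
    pigeonhole : ∀ {m n} (f : Vec Carrier m → Vec Carrier n) →
                 (∀ {as bs} → f as ≡ f bs → as ≡ bs) → m ℕ.≤ n
    pigeonhole {m} {n} f f-injective = ≮⇒≥ λ n<m →
      <⇒≱ (^-monoʳ-< q 1<q n<m)
          (injective⇒≤ {f = N.to ∘ f ∘ M.from}
            (Mˢ.injective ∘ f-injective ∘ N.injective))
      where
      module M  = Inverse (enumerateVec m)
      module Mˢ = Injection (↔⇒↣ (↔-sym (enumerateVec m)))
      module N  = Injection (↔⇒↣ (enumerateVec n))

  -- Vector space laws and cancellation inside subspaces.

  ⊖_ : F⁴ → F⁴
  ⊖_ = map -_

  ⊕-abelianGroup : AbelianGroup 0ℓ 0ℓ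
  ⊕-abelianGroup = record
    { _∙_ = _⊕_
    ; ε   = 𝟎
    ; _⁻¹ = ⊖_
    ; isAbelianGroup = record
      { isGroup = record
        { isMonoid = record
          { isSemigroup = record
            { isMagma = record
              { isEquivalence = isEquivalence
              ; ∙-cong        = cong₂ _⊕_
              }
            ; assoc = zipWith-assoc +-assoc
            }
          ; identity = zipWith-identityˡ +-identityˡ , zipWith-identityʳ +-identityʳ
          }
        ; inverse = zipWith-inverseˡ {⁻¹ = -_} -‿inverseˡ , zipWith-inverseʳ {⁻¹ = -_} -‿inverseʳ
        ; ⁻¹-cong = cong ⊖_
        }
      ; comm = zipWith-comm +-comm
      }
    }

  open AbelianGroup ⊕-abelianGroup using () renaming
    ( assoc to ⊕-assoc; comm to ⊕-comm; identityˡ to ⊕-identityˡ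
    ; identityʳ to ⊕-identityʳ
    ; commutativeSemigroup to ⊕-commutativeSemigroup )
  open AbelianGroupProperties ⊕-abelianGroup using () renaming
    ( ∙-cancelˡ to ⊕-cancelˡ; ∙-cancelʳ to ⊕-cancelʳ )
  open AbelianGroupProperties +-abelianGroup using () renaming
    ( x∙y⁻¹≈ε⇒x≈y to x-y≡0⇒x≡y )

  ·-distribˡ : ∀ {n} a (u v : Vec Carrier n) →
               map (a *_) (zipWith _+_ u v) ≡ zipWith _+_ (map (a *_) u) (map (a *_) v)
  ·-distribˡ a []      []      = refl
  ·-distribˡ a (x ∷ u) (y ∷ v) = cong₂ _∷_ (distribˡ a x y) (·-distribˡ a u v)

  ·-distribʳ : ∀ {n} a b (v : Vec Carrier n) →
               map ((a + b) *_) v ≡ zipWith _+_ (map (a *_) v) (map (b *_) v)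
  ·-distribʳ a b []      = refl
  ·-distribʳ a b (x ∷ v) = cong₂ _∷_ (distribʳ x a b) (·-distribʳ a b v)

  ·-assoc : ∀ a b v → (a * b) · v ≡ a · (b · v)
  ·-assoc a b v = trans (map-cong (*-assoc a b) v) (map-∘ (a *_) (b *_) v)

  ·-identity : ∀ v → 1# · v ≡ v
  ·-identity v = trans (map-cong *-identityˡ v) (map-id v)

  ·-zeroˡ : ∀ v → 0# · v ≡ 𝟎
  ·-zeroˡ v = trans (map-cong zeroˡ v) (map-const v 0#)

  ·-zeroʳ : ∀ a → a · 𝟎 ≡ 𝟎
  ·-zeroʳ a = cong (λ x → x ∷ x ∷ x ∷ x ∷ []) (zeroʳ a)

  -·-inverse : ∀ a v → (- a) · v ⊕ a · v ≡ 𝟎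
  -·-inverse a v = begin
    (- a) · v ⊕ a · v ≡⟨ ·-distribʳ (- a) a v ⟨
    (- a + a) · v     ≡⟨ cong (_· v) (-‿inverseˡ a) ⟩
    0# · v            ≡⟨ ·-zeroˡ v ⟩
    𝟎                 ∎
    where open ≡-Reasoning

  module _ (U : Subspace) where

    ⊕-cancelˡ-∈ : ∀ {u v} → u ∈ ⟦ U ⟧ → u ⊕ v ∈ ⟦ U ⟧ → v ∈ ⟦ U ⟧
    ⊕-cancelˡ-∈ {u} {v} u∈ u⊕v∈ =
      subst ⟦ U ⟧ eq (⊕-closed U (·-closed U (- 1#) u∈) u⊕v∈)
      where
      open ≡-Reasoning
      eq : (- 1#) · u ⊕ (u ⊕ v) ≡ v
      eq = begin
        (- 1#) · u ⊕ (u ⊕ v)      ≡⟨ ⊕-assoc ((- 1#) · u) u v ⟨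
        (- 1#) · u ⊕ u ⊕ v        ≡⟨ cong (λ w → (- 1#) · u ⊕ w ⊕ v) (·-identity u) ⟨
        (- 1#) · u ⊕ 1# · u ⊕ v   ≡⟨ cong (_⊕ v) (-·-inverse 1# u) ⟩
        𝟎 ⊕ v                     ≡⟨ ⊕-identityˡ v ⟩
        v                         ∎

    ⊕-cancelʳ-∈ : ∀ {u v} → v ∈ ⟦ U ⟧ → u ⊕ v ∈ ⟦ U ⟧ → u ∈ ⟦ U ⟧
    ⊕-cancelʳ-∈ {u} {v} v∈ u⊕v∈ = ⊕-cancelˡ-∈ v∈ (subst ⟦ U ⟧ (⊕-comm u v) u⊕v∈)

    ·-cancel-∈ : ∀ {a v} → a ≢ 0# → a · v ∈ ⟦ U ⟧ → v ∈ ⟦ U ⟧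
    ·-cancel-∈ {a} {v} a≢0 av∈ = subst ⟦ U ⟧ eq (·-closed U b av∈)
      where
      open ≡-Reasoning
      b = proj₁ (inverse a a≢0)
      eq : b · (a · v) ≡ v
      eq = begin
        b · (a · v) ≡⟨ ·-assoc b a v ⟨
        (b * a) · v ≡⟨ cong (_· v) (trans (*-comm b a) (proj₂ (inverse a a≢0))) ⟩
        1# · v      ≡⟨ ·-identity v ⟩
        v           ∎

  -- The zero subspace, joins and spans.

  Zero : Subspace
  Zero = record
    { ⟦_⟧      = _≡ 𝟎
    ; member?  = _≟ᵥ 𝟎
    ; 𝟎-closed = refl
    ; ⊕-closed = λ { refl refl → ⊕-identityˡ 𝟎 }
    ; ·-closed = λ { a refl → ·-zeroʳ a }
    }

  -- w lies in U + ⟨ v ⟩ iff w + c v ∈ U for some c; this form makes membership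
  -- a search over the scalar alone.
  infixl 6 _∨_
  _∨_ : Subspace → F⁴ → Subspace
  U ∨ v = record
    { ⟦_⟧      = λ w → ∃[ c ] w ⊕ c · v ∈ ⟦ U ⟧
    ; member?  = λ w → search enumeration (λ c → member? U (w ⊕ c · v))
    ; 𝟎-closed = 0# , subst ⟦ U ⟧
        (sym (trans (⊕-identityˡ (0# · v)) (·-zeroˡ v))) (𝟎-closed U)
    ; ⊕-closed = λ {w} {w′} (c , p) (c′ , p′) → c + c′ , subst ⟦ U ⟧
        (trans (interchange ⊕-commutativeSemigroup w (c · v) w′ (c′ · v))
               (cong (w ⊕ w′ ⊕_) (sym (·-distribʳ c c′ v))))
        (⊕-closed U p p′)
    ; ·-closed = λ a {w} (c , p) → a * c , subst ⟦ U ⟧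
        (trans (·-distribˡ a w (c · v)) (cong (a · w ⊕_) (sym (·-assoc a c v))))
        (·-closed U a p)
    }

  ∨-upper : ∀ U v → U ≤ U ∨ v
  ∨-upper U v {w} w∈ = 0# , subst ⟦ U ⟧
    (sym (trans (cong (w ⊕_) (·-zeroˡ v)) (⊕-identityʳ w))) w∈

  ∈-∨ : ∀ U v → v ∈ ⟦ U ∨ v ⟧
  -- The scalar is minus one because the join adds `c · v` to land in `U`.
  ∈-∨ U v = - 1# , subst ⟦ U ⟧ (sym eq) (𝟎-closed U)
    where
    eq : v ⊕ (- 1#) · v ≡ 𝟎
    eq = trans (⊕-comm v _)
      (trans (cong ((- 1#) · v ⊕_) (sym (·-identity v))) (-·-inverse 1# v))

  ∨-least : ∀ U v W → U ≤ W → v ∈ ⟦ W ⟧ → U ∨ v ≤ W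
  ∨-least U v W U≤W v∈W (c , p) = ⊕-cancelʳ-∈ W (·-closed W c v∈W) (U≤W p)

  Span : F⁴ → Subspace
  Span v = Zero ∨ v

  Span-least : ∀ v W → v ∈ ⟦ W ⟧ → Span v ≤ W
  Span-least v W = ∨-least Zero v W λ { refl → 𝟎-closed W }

  -- Dimension bounds by cardinality.

  -- Encodes dim U ≥ n: as U has q^(dim U) vectors, the bound amounts to an injection of F^n into U,
  -- linear or not.
  record AtLeast (n : ℕ) (U : Subspace) : Set where
    field
      embed     : Vec Carrier n → F⁴
      embed∈    : ∀ as → embed as ∈ ⟦ U ⟧
      injective : ∀ as bs → embed as ≡ embed bs → as ≡ bs

  -- Encodes dim U ≤ n. The coordinates may depend on the membership proof, since for `U ∨ v` that
  -- proof carries the scalar that becomes the new coordinate; injectivity therefore ranges over all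
  -- pairs of proofs.
  record AtMost (n : ℕ) (U : Subspace) : Set where
    field
      coords    : ∀ v → v ∈ ⟦ U ⟧ → Vec Carrier n
      injective : ∀ {u v} u∈ v∈ → coords u u∈ ≡ coords v v∈ → u ≡ v

  AtLeast-zero : ∀ U → AtLeast 0 U
  AtLeast-zero U = record
    { embed     = λ _ → 𝟎
    ; embed∈    = λ _ → 𝟎-closed U
    ; injective = λ { [] [] _ → refl }
    }

  -- The multiples of `v` supply one more coordinate. If two sums agree with different multiples, a
  -- nonzero multiple of `v` is a difference of vectors of `U`, which puts `v` in `U`.
  AtLeast-suc : ∀ {n v} U W → AtLeast n U → U ≤ W → v ∈ ⟦ W ⟧ → v ∉ ⟦ U ⟧ →
                AtLeast (suc n) W
  AtLeast-suc {n} {v} U W n≤U U≤W v∈W v∉U = record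
    { embed     = embed′
    ; embed∈    = λ { (a ∷ as) → ⊕-closed W (·-closed W a v∈W) (U≤W (embed∈ as)) }
    ; injective = injective′
    }
    where
    open AtLeast n≤U
    embed′ : Vec Carrier (suc n) → F⁴
    embed′ (a ∷ as) = a · v ⊕ embed as
    injective′ : ∀ as bs → embed′ as ≡ embed′ bs → as ≡ bs
    injective′ (a ∷ as) (b ∷ bs) eq with a ≟ b
    ... | yes refl = cong (a ∷_) (injective as bs (⊕-cancelˡ (a · v) _ _ eq))
    ... | no a≢b   = contradiction
      (·-cancel-∈ U (a≢b ∘ x-y≡0⇒x≡y a b)
        (⊕-cancelʳ-∈ U (embed∈ as) (subst ⟦ U ⟧ (sym difference) (embed∈ bs))))
      v∉U
      where
      open ≡-Reasoning
      a≡ : b + (a + - b) ≡ a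
      a≡ = trans (+-comm b _) (trans (+-assoc a (- b) b)
        (trans (cong (a +_) (-‿inverseˡ b)) (+-identityʳ a)))
      difference : (a + - b) · v ⊕ embed as ≡ embed bs
      difference = ⊕-cancelˡ (b · v) _ _ (begin
        b · v ⊕ ((a + - b) · v ⊕ embed as) ≡⟨ ⊕-assoc (b · v) _ _ ⟨
        b · v ⊕ (a + - b) · v ⊕ embed as   ≡⟨ cong (_⊕ embed as) (·-distribʳ b (a + - b) v) ⟨
        (b + (a + - b)) · v ⊕ embed as     ≡⟨ cong (λ c → c · v ⊕ embed as) a≡ ⟩
        a · v ⊕ embed as                   ≡⟨ eq ⟩
        b · v ⊕ embed bs                   ∎)

  AtMost-four : ∀ U → AtMost 4 U
  AtMost-four U = record { coords = λ v _ → v ; injective = λ _ _ → id }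

  AtMost-Zero : AtMost 0 Zero
  AtMost-Zero = record
    { coords = λ _ _ → [] ; injective = λ u≡𝟎 v≡𝟎 _ → trans u≡𝟎 (sym v≡𝟎) }

  -- A vector `w` is recovered from the scalar `c` and the coordinates of `w ⊕ c · v` in `U` by
  -- cancelling `c · v`.
  AtMost-∨ : ∀ {n} U v → AtMost n U → AtMost (suc n) (U ∨ v)
  AtMost-∨ U v U≤n = record
    { coords    = λ w (c , p) → c ∷ coords (w ⊕ c · v) p
    ; injective = λ {w} {w′} → λ
      { (c , p) (c′ , p′) eq → injective′ c c′ p p′ eq }
    }
    where
    open AtMost U≤n
    injective′ : ∀ {w w′} c c′ p p′ →
      c ∷ coords (w ⊕ c · v) p ≡ c′ ∷ coords (w′ ⊕ c′ · v) p′ → w ≡ w′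
    injective′ c c′ p p′ eq with cong head eq | cong tail eq
    ... | refl | eq′ = ⊕-cancelʳ (c · v) _ _ (injective p p′ eq′)

  AtLeast⇒≤AtMost : ∀ {m n} U → AtLeast m U → AtMost n U → m ℕ.≤ n
  AtLeast⇒≤AtMost U m≤U U≤n = pigeonhole
    (λ as → coords (embed as) (embed∈ as)) (≥.injective _ _ ∘ injective _ _)
    where
    open module ≥ = AtLeast m≤U using (embed; embed∈)
    open AtMost U≤n

  -- A vector of `W` outside `U` would raise the lower bound for `W` to n + 1, above its upper
  -- bound.
  full : ∀ {n} U W → U ≤ W → AtLeast n U → AtMost n W → W ≤ U
  full U W U≤W n≤U W≤n {w} w∈W = decidable-stable (member? U w) λ w∉U →
    n≮n _ (AtLeast⇒≤AtMost W (AtLeast-suc U W n≤U U≤W w∈W w∉U) W≤n)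

  AtLeast-mono : ∀ {n} U W → U ≤ W → AtLeast n U → AtLeast n W
  AtLeast-mono U W U≤W n≤U = record
    { embed = embed ; embed∈ = λ as → U≤W (embed∈ as) ; injective = injective }
    where open AtLeast n≤U

  AtMost-anti : ∀ {n} U W → U ≤ W → AtMost n W → AtMost n U
  AtMost-anti U W U≤W W≤n = record
    { coords = λ v v∈ → coords v (U≤W v∈) ; injective = λ u∈ v∈ → injective _ _ }
    where open AtMost W≤n

  abstract
    -- F⁴ is finite, so a failed inclusion can be turned into a witness by exhaustive search.
    escape : ∀ U W → ¬ (U ≤ W) → ∃[ v ] v ∈ ⟦ U ⟧ × v ∉ ⟦ W ⟧
    escape U W U≰W = decidable-stable
      (search (enumerateVec 4) λ v → member? U v ×-dec ¬? (member? W v))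
      λ none → U≰W λ {v} v∈U → decidable-stable (member? W v) λ v∉W →
        none (v , v∈U , v∉W)

    escape-dim : ∀ {m n} U W → AtLeast n U → AtMost m W → m ℕ.< n →
                 ∃[ v ] v ∈ ⟦ U ⟧ × v ∉ ⟦ W ⟧
    escape-dim U W n≤U W≤m m<n = escape U W λ U≤W →
      <⇒≱ m<n (AtLeast⇒≤AtMost U n≤U (AtMost-anti U W (λ {v} → U≤W {v}) W≤m))

  -- Bases, the bounds they give, and the point spanned by a vector.

  combination-zero : ∀ {d} (vs : Vec F⁴ d) → combination (replicate d 0#) vs ≡ 𝟎
  combination-zero []       = refl
  combination-zero (v ∷ vs) =
    trans (cong₂ _⊕_ (·-zeroˡ v) (combination-zero vs)) (⊕-identityˡ 𝟎)

  combination-⊕ : ∀ {d} as bs (vs : Vec F⁴ d) →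
    combination (zipWith _+_ as bs) vs ≡ combination as vs ⊕ combination bs vs
  combination-⊕ []       []       []       = sym (⊕-identityˡ 𝟎)
  combination-⊕ (a ∷ as) (b ∷ bs) (v ∷ vs) =
    trans (cong₂ _⊕_ (·-distribʳ a b v) (combination-⊕ as bs vs))
          (interchange ⊕-commutativeSemigroup (a · v) (b · v) _ _)

  combination∈ : ∀ {d} U as {vs : Vec F⁴ d} → All (_∈ ⟦ U ⟧) vs → combination as vs ∈ ⟦ U ⟧
  combination∈ U []       []         = 𝟎-closed U
  combination∈ U (a ∷ as) (v∈ ∷ vs∈) =
    ⊕-closed U (·-closed U a v∈) (combination∈ U as vs∈)

  module _ {d : ℕ} (U : Subspace) (U-dim : HasDimension U d) where
    open HasDimension U-dim

    AtMost-dim : AtMost d U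
    AtMost-dim = record
      { coords    = λ v v∈ → proj₁ (spanning v v∈)
      ; injective = λ u∈ v∈ eq → trans (sym (proj₂ (spanning _ u∈)))
          (trans (cong (λ as → combination as basis) eq) (proj₂ (spanning _ v∈)))
      }

    AtLeast-dim : AtLeast d U
    AtLeast-dim = record
      { embed     = λ as → combination as basis
      ; embed∈    = λ as → combination∈ U as basis∈
      ; injective = λ as bs eq → minus-zero as bs (independent _ (begin
          combination (zipWith _+_ as (map -_ bs)) basis
            ≡⟨ combination-⊕ as (map -_ bs) basis ⟩
          combination as basis ⊕ combination (map -_ bs) basis
            ≡⟨ cong (_⊕ combination (map -_ bs) basis) eq ⟩
          combination bs basis ⊕ combination (map -_ bs) basis
            ≡⟨ combination-⊕ bs (map -_ bs) basis ⟨
          combination (zipWith _+_ bs (map -_ bs)) basis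
            ≡⟨ cong (λ cs → combination cs basis) (zipWith-inverseʳ {⁻¹ = -_} -‿inverseʳ bs) ⟩
          combination (replicate d 0#) basis
            ≡⟨ combination-zero basis ⟩
          𝟎 ∎))
      }
      where
      open ≡-Reasoning
      minus-zero : ∀ {n} (as bs : Vec Carrier n) →
                   zipWith _+_ as (map -_ bs) ≡ replicate n 0# → as ≡ bs
      minus-zero []       []       _  = refl
      minus-zero (a ∷ as) (b ∷ bs) eq = cong₂ _∷_
        (x-y≡0⇒x≡y a b (cong head eq))
        (minus-zero as bs (cong tail eq))

  point : ∀ v → v ≢ 𝟎 → Point
  point v v≢𝟎 = record
    { space     = Span v
    ; dimension = record
      { basis       = v ∷ []
      ; basis∈      = ∈-∨ Zero v ∷ []
      -- Membership in the span reads `w ⊕ c · v ≡ 𝟎`, so the coefficient of `w` is minus `c`.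
      ; spanning    = λ w (c , p) → (- c) ∷ [] ,
          trans (⊕-identityʳ _) (⊕-cancelʳ (c · v) _ _ (trans (-·-inverse c v) (sym p)))
      ; independent = λ { (a ∷ []) eq → cong (_∷ []) (decidable-stable (a ≟ 0#) λ a≢0 →
          v≢𝟎 (·-cancel-∈ Zero a≢0 (trans (sym (⊕-identityʳ _)) eq))) }
      }
    }

-- Points and lines in the presence of the polarity.

module PolarGeometry {q : ℕ} (F : FiniteField q) (ζ : PG.SymplecticPolarity F) where
  open PG F
  open Subspace using (member?; 𝟎-closed; ⊕-closed; ·-closed)
  open SymplecticPolarity ζ
  open Symplectic F ζ
  open LinearAlgebra F

  Whole : Subspace
  Whole = record
    { ⟦_⟧      = λ _ → ⊤
    ; member?  = λ _ → yes tt
    ; 𝟎-closed = tt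
    ; ⊕-closed = λ _ _ → tt
    ; ·-closed = λ _ _ → tt
    }

  abstract
    Flat-nonzero : ∀ {d} (U : Flat (suc d)) → ∃[ v ] v ∈ ⟦ space U ⟧ × v ≢ 𝟎
    Flat-nonzero U =
      escape-dim (space U) Zero (AtLeast-dim (space U) (Flat.dimension U)) AtMost-Zero (s≤s z≤n)

  AtLeast-Span : ∀ {v} → v ≢ 𝟎 → AtLeast 1 (Span v)
  AtLeast-Span {v} v≢𝟎 =
    AtLeast-suc Zero (Span v) (AtLeast-zero Zero) (∨-upper Zero v) (∈-∨ Zero v) v≢𝟎

  -- Any nonzero vector of a point spans it, by comparing dimensions.
  point-≤ : ∀ (x : Point) W {v} → v ≢ 𝟎 → v ∈ ⟦ space x ⟧ → v ∈ ⟦ W ⟧ → space x ≤ W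
  point-≤ x W {v} v≢𝟎 v∈x v∈W = Span-least v W v∈W ∘
    full (Span v) (space x) (Span-least v (space x) v∈x)
      (AtLeast-Span v≢𝟎) (AtMost-dim (space x) (Flat.dimension x))

  point-≤⇒≈ : ∀ (x y : Point) → space y ≤ space x → x ≈ₚ y
  point-≤⇒≈ x y y≤x =
    full (space y) (space x) y≤x (AtLeast-dim (space y) (Flat.dimension y))
      (AtMost-dim (space x) (Flat.dimension x)) , y≤x

  infix 4 _≤?_ _≈?_

  -- One nonzero vector generates the point, so testing that vector alone decides the inclusion.
  _≤?_ : ∀ (x : Point) W → Dec (space x ≤ W)
  x ≤? W = map′ (λ g∈W → point-≤ x W g≢𝟎 g∈x g∈W) (λ x≤W → x≤W g∈x) (member? W g)
    where
    g   = proj₁ (Flat-nonzero x)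
    g∈x = proj₁ (proj₂ (Flat-nonzero x))
    g≢𝟎 = proj₂ (proj₂ (Flat-nonzero x))

  _≈?_ : ∀ (x y : Point) → Dec (x ≈ₚ y)
  x ≈? y = map′ (λ y≤x → point-≤⇒≈ x y (λ {v} → y≤x {v})) proj₂ (y ≤? space x)

  ≤-by-points : ∀ U W → (∀ x → space x ≤ U → space x ≤ W) → U ≤ W
  ≤-by-points U W h {v} v∈U with v ≟ᵥ 𝟎
  ... | yes refl = 𝟎-closed W
  ... | no v≢𝟎   = h (point v v≢𝟎) (Span-least v U v∈U) (∈-∨ Zero v)

  ≈ₚ-sym : ∀ (x y : Point) → x ≈ₚ y → y ≈ₚ x
  ≈ₚ-sym x y (x≤y , y≤x) = y≤x , x≤y

  -- Two distinct points span a subspace of dimension at least 2 inside `l`, hence all of `l`.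
  line-≤ : ∀ (l : Line) x y U → x on l → y on l → ¬ (x ≈ₚ y) →
           space x ≤ U → space y ≤ U → space l ≤ U
  line-≤ l x y U x≤l y≤l x≉y x≤U y≤U =
    ∨-least (space x) g U x≤U (y≤U g∈y) ∘
    full xy (space l) (∨-least (space x) g (space l) x≤l (y≤l g∈y))
      (AtLeast-suc (space x) xy (AtLeast-dim (space x) (Flat.dimension x))
        (∨-upper (space x) g) (∈-∨ (space x) g)
        (x≉y ∘ point-≤⇒≈ x y ∘ point-≤ y (space x) g≢𝟎 g∈y))
      (AtMost-dim (space l) (Flat.dimension l))
    where
    g   = proj₁ (Flat-nonzero y)
    g∈y = proj₁ (proj₂ (Flat-nonzero y))
    g≢𝟎 = proj₂ (proj₂ (Flat-nonzero y))
    xy  = space x ∨ g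

  -- Lattice properties of the polarity.

  ζ-swap : ∀ U W → U ≤ W ^ζ → W ≤ U ^ζ
  ζ-swap U W U≤Wζ = reversing U (W ^ζ) U≤Wζ ∘ proj₂ (involutive W)

  ζ-swap′ : ∀ U W → W ^ζ ≤ U → U ^ζ ≤ W
  ζ-swap′ U W Wζ≤U = proj₁ (involutive W) ∘ reversing (W ^ζ) U Wζ≤U

  -- Dual to the minimality of points: `W ^ζ` lies in `x`, and a nonzero vector in it would give
  -- `x ≤ W ^ζ` and so `W ≤ x ^ζ`. Hence `W ^ζ` is zero and `W` is everything.
  ζ-maximal : ∀ (x : Point) W → space x ^ζ ≤ W → ¬ (W ≤ space x ^ζ) → ∀ U → U ≤ W
  ζ-maximal x W xζ≤W W≰xζ U =
    proj₁ (involutive W) ∘ ζ-swap (W ^ζ) U (Wζ≤ (U ^ζ))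
    where
    Wζ≤ : ∀ V → W ^ζ ≤ V
    Wζ≤ V {v} v∈Wζ with v ≟ᵥ 𝟎
    ... | yes refl = 𝟎-closed V
    ... | no v≢𝟎   = ⊥-elim (W≰xζ (ζ-swap (space x) W
      (point-≤ x (W ^ζ) v≢𝟎 (ζ-swap′ W (space x) xζ≤W v∈Wζ) v∈Wζ)))

  abstract
    -- A line meets a hyperplane. If `a` on the line is outside `x ^ζ`, then by maximality `x ^ζ`
    -- and `a` span everything, so a second independent vector `b` of the line can be moved into
    -- `x ^ζ` by a multiple of `a`.
    line-meets-ζ : ∀ (x : Point) (l : Line) →
                   ∃[ v ] v ≢ 𝟎 × v ∈ ⟦ space l ⟧ × v ∈ ⟦ space x ^ζ ⟧
    line-meets-ζ x l with Flat-nonzero l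
    ... | a , a∈l , a≢𝟎 with member? (space x ^ζ) a
    ... | yes a∈xζ = a , a≢𝟎 , a∈l , a∈xζ
    ... | no  a∉xζ
      with b , b∈l , b∉a ← escape-dim (space l) (Span a)
             (AtLeast-dim (space l) (Flat.dimension l)) (AtMost-∨ Zero a AtMost-Zero)
             (s≤s (s≤s z≤n))
      with c , b+ca∈xζ ← ζ-maximal x (space x ^ζ ∨ a) (∨-upper (space x ^ζ) a)
             (λ h → a∉xζ (h (∈-∨ (space x ^ζ) a))) (Span b) (∈-∨ Zero b)
      -- Nonzero because `b ⊕ c · a ≡ 𝟎` is, by the encoding of the join, membership of `b` in
      -- `Span a`.
      = b ⊕ c · a , (λ eq → b∉a (c , eq)) ,
        ⊕-closed (space l) b∈l (·-closed (space l) c a∈l) , b+ca∈xζ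

  -- Otherwise m < l ^ζ < p ^ζ < V, with p a point of l, would force dim V ≥ 5.
  line-ζ-≤ : ∀ (l m : Line) → space m ≤ space l ^ζ → space l ^ζ ≤ space m
  line-ζ-≤ l m m≤lζ {z} z∈lζ with a , a∈l , a≢𝟎 ← Flat-nonzero l =
    decidable-stable (member? (space m) z) λ z∉m →
      let lζ≥3 = AtLeast-suc (space m) (space l ^ζ)
                   (AtLeast-dim (space m) (Flat.dimension m)) m≤lζ z∈lζ z∉m
          w , w∈pζ , w∉lζ = escape (space p ^ζ) (space l ^ζ) pζ≰lζ
          pζ≥4 = AtLeast-suc (space l ^ζ) (space p ^ζ) lζ≥3
                   (reversing (space p) (space l) p≤l) w∈pζ w∉lζ
          V≤pζ = full (space p ^ζ) Whole (λ _ → tt) pζ≥4 (AtMost-four Whole)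
      in a≢𝟎 (ζ-swap′ Whole Zero (λ _ → tt) (ζ-swap Whole (space p) V≤pζ (∈-∨ Zero a)))
    where
    p = point a a≢𝟎
    p≤l : p on l
    p≤l = Span-least a (space l) a∈l
    pζ≰lζ : ¬ (space p ^ζ ≤ space l ^ζ)
    pζ≰lζ pζ≤lζ = <⇒≱ (s≤s (s≤s z≤n)) (AtLeast⇒≤AtMost (space p)
      (AtLeast-mono (space l) (space p) l≤p (AtLeast-dim (space l) (Flat.dimension l)))
      (AtMost-∨ Zero a AtMost-Zero))
      where
      l≤p : space l ≤ space p
      l≤p = proj₁ (involutive (space p)) ∘ ζ-swap (space p ^ζ) (space l) pζ≤lζ

  ⊥-refl : ∀ x → x ⊥ x
  ⊥-refl x = absolute x

  -- Swapping sides turns the claim for a point `y` of `m` into `l ≤ y ^ζ`, which can again be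
  -- tested on points.
  Orthogonal⇒≤ : ∀ l m → Orthogonal l m → space m ≤ space l ^ζ
  Orthogonal⇒≤ l m l⊥m = ≤-by-points (space m) (space l ^ζ) λ y y≤m →
    ζ-swap (space l) (space y) (≤-by-points (space l) (space y ^ζ) λ x x≤l →
      ⊥-sym {x} {y} (l⊥m x y x≤l y≤m))

  Orthogonal-sym : ∀ l m → Orthogonal l m → Orthogonal m l
  Orthogonal-sym l m l⊥m x y x≤m y≤l = ⊥-sym {y} {x} (l⊥m y x y≤l x≤m)

  -- Lines of a special spread and their pairing.

  module Spread (S : SpecialSpread) where
    open SpecialSpread S using (isSpread; non-isotropic; pairing)
    open IsSpread isSpread

    line : Point → Line
    line x = proj₁ (partition x)

    line∈ : ∀ x → line x ∈ lines S
    line∈ x = proj₁ (proj₁ (proj₂ (partition x)))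

    on-line : ∀ x → x on line x
    on-line x = proj₂ (proj₁ (proj₂ (partition x)))

    line-unique : ∀ x {l} → l ∈ lines S → x on l → line x ≈ₗ l
    line-unique x {l} l∈S x≤l = proj₂ (proj₂ (partition x)) {l} (l∈S , λ {v} → x≤l {v})

    mate : Point → Line
    mate x = proj₁ (pairing (line x) (line∈ x))

    mate∈ : ∀ x → mate x ∈ lines S
    mate∈ x = proj₁ (proj₁ (proj₂ (pairing (line x) (line∈ x))))

    mate-⊥ : ∀ x → Orthogonal (line x) (mate x)
    mate-⊥ x = proj₂ (proj₁ (proj₂ (pairing (line x) (line∈ x))))

    mate-unique : ∀ x {l} → l ∈ lines S → Orthogonal (line x) l → mate x ≈ₗ l
    mate-unique x {l} l∈S ⊥l = proj₂ (proj₂ (pairing (line x) (line∈ x))) {l} (l∈S , ⊥l)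

    meet⇒≈ : ∀ l m → l ∈ lines S → m ∈ lines S → ∀ {v} → v ≢ 𝟎 →
             v ∈ ⟦ space l ⟧ → v ∈ ⟦ space m ⟧ → l ≈ₗ m
    meet⇒≈ l m l∈S m∈S {v} v≢𝟎 v∈l v∈m =
      let x = point v v≢𝟎
          Lx≤l , l≤Lx = line-unique x l∈S (Span-least v (space l) v∈l)
          Lx≤m , m≤Lx = line-unique x m∈S (Span-least v (space m) v∈m)
      in Lx≤m ∘ l≤Lx , Lx≤l ∘ m≤Lx

    -- By `line-ζ-≤` applied to `l` twice, such an inclusion is an equality, making `l` totally
    -- isotropic.
    no-absolute : ∀ l → l ∈ lines S → ¬ (space l ≤ space l ^ζ)
    no-absolute l l∈S l≤lζ = non-isotropic l l∈S (line-ζ-≤ l l l≤lζ , l≤lζ)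

    line≉mate : ∀ x → ¬ (line x ≈ₗ mate x)
    line≉mate x (Lx≤m , _) = no-absolute (line x) (line∈ x)
      (Orthogonal⇒≤ (line x) (mate x) (mate-⊥ x) ∘ Lx≤m)

    -- Distinct orthogonal points of `l` span it, so both would be orthogonal to all of `l`, and `l`
    -- would lie in `l ^ζ`.
    ⊥-collinear⇒≈ : ∀ l → l ∈ lines S → ∀ x y → x on l → y on l → x ⊥ y → x ≈ₚ y
    ⊥-collinear⇒≈ l l∈S x y x≤l y≤l x⊥y = decidable-stable (x ≈? y) λ x≉y →
      let l≤xζ = line-≤ l x y (space x ^ζ) x≤l y≤l x≉y (⊥-refl x) x⊥y
          l≤yζ = line-≤ l x y (space y ^ζ) x≤l y≤l x≉y (⊥-sym {x} {y} x⊥y) (⊥-refl y)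
      in no-absolute l l∈S (line-≤ l x y (space l ^ζ) x≤l y≤l x≉y
           (ζ-swap (space l) (space x) l≤xζ) (ζ-swap (space l) (space y) l≤yζ))

    -- The points `x` and `y` span the line, so `z` lies in its polar, which is the paired line.
    ⊥-both⇒mate : ∀ x y z → y on line x → ¬ (x ≈ₚ y) → x ⊥ z → y ⊥ z → z on mate x
    ⊥-both⇒mate x y z y≤Lx x≉y x⊥z y⊥z =
      line-ζ-≤ (line x) (mate x) (Orthogonal⇒≤ (line x) (mate x) (mate-⊥ x)) ∘
      ζ-swap (space (line x)) (space z)
        (line-≤ (line x) x y (space z ^ζ) (on-line x) y≤Lx x≉y
          (⊥-sym {x} {z} x⊥z) (⊥-sym {y} {z} y⊥z))

    -- The spread has only one line through `x`, and that line has only one partner, so the lines in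
    -- the pair edge are forced. This makes removed edges decidable.
    PairEdge⇒mate : ∀ x y → PairEdge S x y → y on mate x
    PairEdge⇒mate x y (l , m , l∈S , m∈S , l⊥m , inj₁ (x≤l , y≤m)) =
      let Lx≤l , _ = line-unique x l∈S x≤l
          _ , m≤mx = mate-unique x {m} m∈S (λ u v u≤Lx v≤m → l⊥m u v (Lx≤l ∘ u≤Lx) v≤m)
      in m≤mx ∘ y≤m
    PairEdge⇒mate x y (l , m , l∈S , m∈S , l⊥m , inj₂ (x≤m , y≤l)) =
      PairEdge⇒mate x y (m , l , m∈S , l∈S , Orthogonal-sym l m l⊥m , inj₁ (x≤m , y≤l))

    mate⇒PairEdge : ∀ x y → y on mate x → PairEdge S x y
    mate⇒PairEdge x y y≤m =
      line x , mate x , line∈ x , mate∈ x , mate-⊥ x , inj₁ (on-line x , y≤m)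

    PairEdge? : ∀ x y → Dec (PairEdge S x y)
    PairEdge? x y = map′ (mate⇒PairEdge x y) (PairEdge⇒mate x y) (y ≤? space (mate x))

    -- Edges that survive the removal, and their common neighbours.

    infix 4 _~_

    infix 4 _~?_
    _~_ : Point → Point → Set₁
    x ~ y = Graph.Adj Sp₄ x y × ¬ PairEdge S x y

    _~?_ : ∀ x y → Dec (x ~ y)
    x ~? y = (¬? (x ≈? y) ×-dec (y ≤? space x ^ζ)) ×-dec ¬? (PairEdge? x y)

    ~-resp : ∀ x x′ y y′ → x ≈ₚ x′ → y ≈ₚ y′ → x ~ y → x′ ~ y′
    ~-resp = Adj-resp (removeEdges Sp₄ (PairEdge S)
      (λ {x} {y} → PairEdge-sym S {x} {y})
      (λ {x} {y} {z} → PairEdge-respʳ S {x} {y} {z}))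

    mate-sym : ∀ x y → y on mate x → x on mate y
    mate-sym x y = PairEdge⇒mate y x ∘ PairEdge-sym S {x} {y} ∘ mate⇒PairEdge x y

    -- Pairing is an involution, because `PairEdge` is symmetric.
    mate-mate : ∀ x y → y on mate x → line x ≈ₗ mate y
    mate-mate x y y≤mx = line-unique x (mate∈ y) (mate-sym x y y≤mx)

    -- A common point of the two mates would have both `line x` and `line y` as its own mate.
    mates-disjoint : ∀ x y → ¬ (y on line x) → ∀ {v} → v ≢ 𝟎 →
                     v ∈ ⟦ space (mate x) ⟧ → ¬ (v ∈ ⟦ space (mate y) ⟧)
    mates-disjoint x y y≰Lx {v} v≢𝟎 v∈mx v∈my =
      let p = point v v≢𝟎
          _ , mp≤Lx = mate-mate x p (Span-least v (space (mate x)) v∈mx)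
          Ly≤mp , _ = mate-mate y p (Span-least v (space (mate y)) v∈my)
      in y≰Lx (mp≤Lx ∘ Ly≤mp ∘ on-line y)

    mate-⊥-self : ∀ x {v} → v ∈ ⟦ space (mate x) ⟧ → v ∈ ⟦ space x ^ζ ⟧
    mate-⊥-self x v∈mx = reversing (space x) (space (line x)) (on-line x)
      (Orthogonal⇒≤ (line x) (mate x) (mate-⊥ x) v∈mx)

    collinear⇒≁ : ∀ l → l ∈ lines S → ∀ x y → x on l → y on l → ¬ (x ~ y)
    collinear⇒≁ l l∈S x y x≤l y≤l ((x≉y , x⊥y) , _) =
      x≉y (⊥-collinear⇒≈ l l∈S x y x≤l y≤l x⊥y)

    -- A point orthogonal to both lies on the paired line, and its edges to `x` have been removed.
    collinear⇒no-common : ∀ x y z → y on line x → ¬ (x ≈ₚ y) → x ~ z → ¬ (y ~ z)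
    collinear⇒no-common x y z y≤Lx x≉y ((_ , x⊥z) , ¬e) ((_ , y⊥z) , _) =
      ¬e (mate⇒PairEdge x z (⊥-both⇒mate x y z y≤Lx x≉y x⊥z y⊥z))

    -- A third point of the totally isotropic line xy.
    paired-common : ∀ x y → y on mate x → ∃[ z ] (x ~ z × y ~ z)
    paired-common x y y≤mx =
      z ,
      (((λ (_ , z≤x) → ab∉Lx (on-line x (z≤x ab∈z))) ,
        Span-least ab (space x ^ζ)
          (⊕-closed (space x ^ζ) (⊥-refl x a∈x) (mate-⊥-self x (y≤mx b∈y)))) ,
       λ e → ab∉mx (PairEdge⇒mate x z e ab∈z)) ,
      (((λ (_ , z≤y) → ab∉mx (y≤mx (z≤y ab∈z))) ,
        Span-least ab (space y ^ζ)
          (⊕-closed (space y ^ζ) (mate-⊥-self y (mate-sym x y y≤mx a∈x)) (⊥-refl y b∈y))) ,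
       λ e → ab∉Lx (proj₂ (mate-mate x y y≤mx) (PairEdge⇒mate y z e ab∈z)))
      where
      a   = proj₁ (Flat-nonzero x)
      a∈x = proj₁ (proj₂ (Flat-nonzero x))
      a≢𝟎 = proj₂ (proj₂ (Flat-nonzero x))
      b   = proj₁ (Flat-nonzero y)
      b∈y = proj₁ (proj₂ (Flat-nonzero y))
      b≢𝟎 = proj₂ (proj₂ (Flat-nonzero y))
      ab  = a ⊕ b
      disjoint : ∀ {v} → v ≢ 𝟎 → v ∈ ⟦ space (line x) ⟧ → ¬ (v ∈ ⟦ space (mate x) ⟧)
      disjoint v≢𝟎 v∈Lx v∈mx =
        line≉mate x (meet⇒≈ (line x) (mate x) (line∈ x) (mate∈ x) v≢𝟎 v∈Lx v∈mx)
      ab∉mx : ab ∉ ⟦ space (mate x) ⟧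
      ab∉mx ab∈mx = disjoint a≢𝟎 (on-line x a∈x)
        (⊕-cancelʳ-∈ (space (mate x)) {a} {b} (y≤mx b∈y) ab∈mx)
      ab∉Lx : ab ∉ ⟦ space (line x) ⟧
      ab∉Lx ab∈Lx = disjoint b≢𝟎
        (⊕-cancelˡ-∈ (space (line x)) {a} {b} (on-line x a∈x) ab∈Lx) (y≤mx b∈y)
      ab≢𝟎 : ab ≢ 𝟎
      ab≢𝟎 eq = ab∉mx (subst ⟦ space (mate x) ⟧ (sym eq) (𝟎-closed (space (mate x))))
      z : Point
      z = point ab ab≢𝟎
      ab∈z : ab ∈ ⟦ space z ⟧
      ab∈z = ∈-∨ Zero ab

    -- Take `u` in `mate x` orthogonal to `y` and `w` in `mate y` orthogonal to `x`; their sum is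
    -- orthogonal to both points. It avoids both mates, as these are disjoint, and it differs from
    -- `x` and `y` since they are not orthogonal to each other.
    unpaired-common : ∀ x y → ¬ (y on line x) → ¬ (x ⊥ y) → ∃[ z ] (x ~ z × y ~ z)
    unpaired-common x y y≰Lx x̸⊥y =
      z ,
      (((λ (x≤z , _) → x̸⊥y (⊥-sym {y} {x} (z≤yζ ∘ x≤z))) , z≤xζ) ,
       λ e → uw∉mx (PairEdge⇒mate x z e uw∈z)) ,
      (((λ (y≤z , _) → x̸⊥y (z≤xζ ∘ y≤z)) , z≤yζ) ,
       λ e → uw∉my (PairEdge⇒mate y z e uw∈z))
      where
      U    = line-meets-ζ y (mate x)
      u    = proj₁ U
      u≢𝟎  = proj₁ (proj₂ U)
      u∈mx = proj₁ (proj₂ (proj₂ U))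
      u∈yζ = proj₂ (proj₂ (proj₂ U))
      W    = line-meets-ζ x (mate y)
      w    = proj₁ W
      w≢𝟎  = proj₁ (proj₂ W)
      w∈my = proj₁ (proj₂ (proj₂ W))
      w∈xζ = proj₂ (proj₂ (proj₂ W))
      uw   = u ⊕ w
      uw∉mx : uw ∉ ⟦ space (mate x) ⟧
      uw∉mx uw∈mx = mates-disjoint x y y≰Lx w≢𝟎
        (⊕-cancelˡ-∈ (space (mate x)) {u} {w} u∈mx uw∈mx) w∈my
      uw∉my : uw ∉ ⟦ space (mate y) ⟧
      uw∉my uw∈my = mates-disjoint x y y≰Lx u≢𝟎 u∈mx
        (⊕-cancelʳ-∈ (space (mate y)) {u} {w} w∈my uw∈my)
      uw≢𝟎 : uw ≢ 𝟎
      uw≢𝟎 eq = uw∉mx (subst ⟦ space (mate x) ⟧ (sym eq) (𝟎-closed (space (mate x))))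
      z : Point
      z = point uw uw≢𝟎
      uw∈z : uw ∈ ⟦ space z ⟧
      uw∈z = ∈-∨ Zero uw
      z≤xζ : x ⊥ z
      z≤xζ = Span-least uw (space x ^ζ)
        (⊕-closed (space x ^ζ) {u} {w} (mate-⊥-self x u∈mx) w∈xζ)
      z≤yζ : y ⊥ z
      z≤yζ = Span-least uw (space y ^ζ)
        (⊕-closed (space y ^ζ) {u} {w} u∈yζ (mate-⊥-self y w∈my))

    abstract
      -- Points on different spread lines can fail to be related by `~` in two ways: their edge was
      -- removed, or they are not orthogonal.
      common-neighbour : ∀ x y → ¬ (y on line x) → ¬ (x ~ y) → ∃[ z ] (x ~ z × y ~ z)
      common-neighbour x y y≰Lx x≁y = by-cases (PairEdge? x y)
        where
        by-cases : Dec (PairEdge S x y) → ∃[ z ] (x ~ z × y ~ z)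
        by-cases (yes e) = paired-common x y (PairEdge⇒mate x y e)
        by-cases (no ¬e) = unpaired-common x y y≰Lx λ x⊥y →
          x≁y (((λ (_ , y≤x) → y≰Lx (on-line x ∘ y≤x)) , x⊥y) , ¬e)

    -- The point where `line y` meets `x ^ζ` works: were its edge to `x` removed, `line y` would
    -- meet `mate x` and so coincide with it.
    unpaired⇒edge : ∀ x y → ¬ (y on line x) → ¬ PairEdge S x y →
                    ∃[ z ] (z on line y × x ~ z)
    unpaired⇒edge x y y≰Lx ¬e with v , v≢𝟎 , v∈Ly , v∈xζ ← line-meets-ζ x (line y) =
      z , z≤Ly ,
      ((λ (x≤z , _) → y≰Lx (proj₂ (line-unique x (line∈ y) (z≤Ly ∘ x≤z)) ∘ on-line y)) ,
        Span-least v (space x ^ζ) v∈xζ) ,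
      λ e → ¬e (mate⇒PairEdge x y
        (proj₁ (meet⇒≈ (line y) (mate x) (line∈ y) (mate∈ x) v≢𝟎 v∈Ly
                  (PairEdge⇒mate x z e (∈-∨ Zero v))) ∘ on-line y))
      where
      z = point v v≢𝟎
      z≤Ly : z on line y
      z≤Ly = Span-least v (space (line y)) v∈Ly

    -- Here `line y` is `mate x`, to all of whose points the edges from `x` were removed.
    paired⇒no-edge : ∀ x y → PairEdge S x y → ∀ z → z on line y → ¬ (x ~ z)
    paired⇒no-edge x y e z z≤Ly (_ , ¬e) = ¬e (mate⇒PairEdge x z
      (proj₁ (line-unique y (mate∈ x) (PairEdge⇒mate x y e)) ∘ z≤Ly))

    paired⇒¬collinear : ∀ x y → PairEdge S x y → ¬ (y on line x)
    paired⇒¬collinear x y e y≤Lx with b , b∈y , b≢𝟎 ← Flat-nonzero y =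
      line≉mate x (meet⇒≈ (line x) (mate x) (line∈ x) (mate∈ x) b≢𝟎
        (y≤Lx b∈y) (PairEdge⇒mate x y e b∈y))

  -- Bijections of points that preserve surviving edges.

  module PointBijection (bijection : Inverse (Flats 1) (Flats 1)) where
    open Inverse bijection public using (to; from)
    open Inverse bijection using (to-cong; from-cong; inverse)

    to-resp : ∀ x y → x ≈ₚ y → to x ≈ₚ to y
    to-resp x y = to-cong {x} {y}

    to-from : ∀ y → to (from y) ≈ₚ y
    to-from y = proj₁ inverse {y} {from y} (id , id)

    from-to : ∀ x → from (to x) ≈ₚ x
    from-to x = proj₂ inverse {x} {to x} (id , id)

    to-injective : ∀ x y → to x ≈ₚ to y → x ≈ₚ y
    to-injective x y fx≈fy =
      let gfx≤gfy , gfy≤gfx = from-cong {to x} {to y} fx≈fy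
          gfx≤x , x≤gfx = from-to x
          gfy≤y , y≤gfy = from-to y
      in gfy≤y ∘ gfx≤gfy ∘ x≤gfx , gfx≤x ∘ gfy≤gfx ∘ y≤gfy

  -- Symmetric in the two spreads, so that each result on `to` yields one on `from` through `flip`.
  record Correspondence (S T : SpecialSpread) : Set₁ where
    private
      module S = Spread S
      module T = Spread T
    field
      bijection : Inverse (Flats 1) (Flats 1)
    open PointBijection bijection public
    field
      to-~   : ∀ x y → x S.~ y → to x T.~ to y
      from-~ : ∀ x y → x T.~ y → from x S.~ from y

  flip : ∀ {S T} → Correspondence S T → Correspondence T S
  flip c = record
    { bijection = Symmetry.inverse bijection ; to-~ = from-~ ; from-~ = to-~ }
    where open Correspondence c

  module _ {S T : SpecialSpread} (c : Correspondence S T) where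
    private
      module S = Spread S
      module T = Spread T
    open Correspondence c

    ~-reflect : ∀ x y → to x T.~ to y → x S.~ y
    ~-reflect x y fx~fy = S.~-resp (from (to x)) x (from (to y)) y (from-to x) (from-to y)
      (from-~ (to x) (to y) fx~fy)

    ~-reflectˡ : ∀ x z → to x T.~ z → x S.~ from z
    ~-reflectˡ x z fx~z = S.~-resp (from (to x)) x (from z) (from z) (from-to x) (id , id)
      (from-~ (to x) z fx~z)

    -- If the images of distinct points lay on different lines of `T`, they would have a common
    -- neighbour, and pulling it back would give one for two points of a line of `S`.
    collinear : ∀ l m → l ∈ lines S → m ∈ lines T → ∀ x y →
                x on l → y on l → to x on m → to y on m
    collinear l m l∈S m∈T x y x≤l y≤l fx≤m = by-cases (x ≈? y)
      where
      y≤Lx : y on S.line x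
      y≤Lx = proj₂ (S.line-unique x l∈S x≤l) ∘ y≤l
      fx≁fy : ¬ (to x T.~ to y)
      fx≁fy fx~fy = S.collinear⇒≁ l l∈S x y x≤l y≤l (~-reflect x y fx~fy)
      by-cases : Dec (x ≈ₚ y) → to y on m
      by-cases (yes x≈y) = fx≤m ∘ proj₂ (to-resp x y x≈y)
      by-cases (no x≉y)  = proj₁ (T.line-unique (to x) m∈T fx≤m) ∘
        decidable-stable (to y ≤? space (T.line (to x))) λ fy≰Lfx →
          let z , fx~z , fy~z = T.common-neighbour (to x) (to y) fy≰Lfx fx≁fy
          in S.collinear⇒no-common x y (from z) y≤Lx x≉y
               (~-reflectˡ x z fx~z) (~-reflectˡ y z fy~z)

  module _ {S T : SpecialSpread} (c : Correspondence S T) where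
    private
      module S = Spread S
      module T = Spread T
    open Correspondence c

    image : ∀ l m → l ∈ lines S → m ∈ lines T → ∀ x → x on l → to x on m → IsImage to l m
    image l m l∈S m∈T x x≤l fx≤m y = mk⇔ preimage on-m
      where
      gy≤l : y on m → from y on l
      gy≤l y≤m =
        collinear (flip c) m l m∈T l∈S (to x) y fx≤m y≤m (x≤l ∘ proj₁ (from-to x))
      preimage : y on m → ∃[ x′ ] (x′ on l × y ≈ₚ to x′)
      preimage y≤m = from y , gy≤l y≤m , ≈ₚ-sym (to (from y)) y (to-from y)
      on-m : ∃[ x′ ] (x′ on l × y ≈ₚ to x′) → y on m
      on-m (x′ , x′≤l , y≤fx′ , _) =
        collinear c l m l∈S m∈T x x′ x≤l x′≤l fx≤m ∘ y≤fx′

    -- Otherwise `to x` has a neighbour on the line of `to y`. Its preimage lies on the line of `y`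
    -- and is a neighbour of `x`, impossible for paired lines.
    paired : ∀ x y → PairEdge S x y → PairEdge T (to x) (to y)
    paired x y e = decidable-stable (T.PairEdge? (to x) (to y)) λ ¬e →
      let z , z≤Lfy , fx~z = T.unpaired⇒edge (to x) (to y) fy≰Lfx ¬e
      in S.paired⇒no-edge x y e (from z) (gz≤Ly z z≤Lfy) (~-reflectˡ c x z fx~z)
      where
      fy≰Lfx : ¬ (to y on T.line (to x))
      fy≰Lfx fy≤Lfx = S.paired⇒¬collinear x y e
        (collinear (flip c) (T.line (to x)) (S.line x) (T.line∈ (to x)) (S.line∈ x)
          (to x) (to y) (T.on-line (to x)) fy≤Lfx
          (S.on-line x ∘ proj₁ (from-to x)) ∘ proj₂ (from-to y))
      gz≤Ly : ∀ z → z on T.line (to y) → from z on S.line y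
      gz≤Ly z z≤Lfy =
        collinear (flip c) (T.line (to y)) (S.line y) (T.line∈ (to y)) (S.line∈ y)
          (to y) z (T.on-line (to y)) z≤Lfy (S.on-line y ∘ proj₁ (from-to y))

    adjacent : ∀ x y → Graph.Adj Sp₄ x y → Graph.Adj Sp₄ (to x) (to y)
    adjacent x y (x≉y , x⊥y) = x≉y ∘ to-injective x y , fx⊥fy (S.PairEdge? x y)
      where
      -- An edge of `Sp₄` either was removed, and pairing is preserved, or survives as `~`.
      fx⊥fy : Dec (PairEdge S x y) → to x ⊥ to y
      fx⊥fy (yes e) = T.mate-⊥-self (to x) ∘ T.PairEdge⇒mate (to x) (to y) (paired x y e)
      fx⊥fy (no ¬e) = proj₂ (proj₁ (to-~ x y ((x≉y , x⊥y) , ¬e)))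

  -- From isomorphisms to equivalences of spreads.

  equivalence : ∀ {S T} → Correspondence S T → Equivalent S T
  equivalence {S} {T} c = φ ,
    (λ l l∈S →
      -- Any point of `l` will do: the image of `l` is the line of `T` through the image of that
      -- point.
      let a , a∈l , a≢𝟎 = Flat-nonzero l
          x = point a a≢𝟎
          x≤l = Span-least a (space l) a∈l
      in T.line (to x) , T.line∈ (to x) ,
         image c l (T.line (to x)) l∈S (T.line∈ (to x)) x x≤l (T.on-line (to x))) ,
    (λ m m∈T →
      let a , a∈m , a≢𝟎 = Flat-nonzero m
          y = point a a≢𝟎
          y≤m = Span-least a (space m) a∈m
      in S.line (from y) , S.line∈ (from y) ,
         image c (S.line (from y)) m (S.line∈ (from y)) m∈T (from y)
           (S.on-line (from y)) (y≤m ∘ proj₁ (to-from y)))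
    where
    module S = Spread S
    module T = Spread T
    open Correspondence c
    φ : Sp₄ ≅ Sp₄
    φ = record
      { bijection = bijection
      ; adjacency = λ x y → mk⇔ (adjacent c x y) λ fx~fy →
          Adj-resp Sp₄ (from (to x)) x (from (to y)) y (from-to x) (from-to y)
            (adjacent (flip c) (to x) (to y) fx~fy)
      }

  -- For distinct points, adjacency in `Γ` is the negation of `~`. Preserving it thus preserves `~`
  -- up to double negation, which decidability of `~` removes.
  Γ-iso⇒correspondence : ∀ S T → Γ S ≅ Γ T → Correspondence S T
  Γ-iso⇒correspondence S T φ = record
    { bijection = bijection
    ; to-~      = λ x y x~y → decidable-stable (to x T.~? to y) λ fx≁fy →
        proj₂ (Equivalence.from (adjacency x y)
          (proj₁ (proj₁ x~y) ∘ to-injective x y , fx≁fy)) x~y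
    ; from-~    = λ x y x~y → decidable-stable (from x S.~? from y) λ gx≁gy →
        proj₂ (Equivalence.to (adjacency (from x) (from y))
          (proj₁ (proj₁ x~y) ∘ flipped.to-injective x y , gx≁gy))
        (T.~-resp x (to (from x)) y (to (from y))
          (≈ₚ-sym (to (from x)) x (to-from x))
          (≈ₚ-sym (to (from y)) y (to-from y)) x~y)
    }
    where
    open _≅_ φ using (bijection; adjacency)
    open PointBijection bijection
    module flipped = PointBijection (Symmetry.inverse bijection)
    module S = Spread S
    module T = Spread T

theorem5 : (q : ℕ) → OddPrimePower q →
    (F : FiniteField q) (ζ : PG.SymplecticPolarity F) →
    let open Symplectic F ζ in
    (S₁ S₂ : SpecialSpread) →
    ¬ Equivalent S₁ S₂ → ¬ (Γ S₁ ≅ Γ S₂)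
theorem5 q _ F ζ S₁ S₂ S₁≄S₂ φ = S₁≄S₂ (equivalence (Γ-iso⇒correspondence S₁ S₂ φ))
  where open PolarGeometry F ζ
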